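{- Let $D$ be a digraph such that every proper induced subdigraph of $D$ satisfies the $\alpha$-property. If $\alpha(D) \geq \frac{|V(D)|}{2}$, then $D$ satisfies the $\alpha$-property.
   Context: All digraphs are finite, without loops and without multiple edges (a pair of opposite edges $uv$, $vu$ is allowed). Two vertices $u,v$ are adjacent if $uv$ or $vu$ is an edge. A stable set is a set of pairwise non-adjacent vertices; $\alpha(D)$ is the maximum cardinality of a stable set of $D$, and a maximum stable set is one of cardinality $\alpha(D)$. A path is a directed path with distinct vertices (a single vertex is a path). A path partition of $D$ is a collection $\mathcal{P}$ of paths of $D$ such that every vertex of $D$ belongs to exactly one path of $\mathcal{P}$. A stable set $S$ and a path partition $\mathcal{P}$ are orthogonal if $|V(P)\cap S|=1$ for every $P\in\mathcal{P}$; in that case $\mathcal{P}$ is called an $S$-path partition. A digraph $D$ satisfies the $\alpha$-property if for every maximum stable set $S$ of $D$ there exists an $S$-path partition of $D$. -}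

module Defs where

open import Data.Bool.Base using (false; true)
open import Data.Fin.Base using (Fin)
open import Data.Fin.Properties using (all?)
open import Data.Fin.Subset
  using (Subset; inside; outside; _∈_; _⊆_; _∩_; ⋃; ⁅_⁆; ∣_∣; ⊥)
open import Data.Fin.Subset.Properties
  using (_∈?_; _⊆?_; ∉⊥; ∣⊥∣≡0)
open import Data.List.Base using (List; []; _∷_; _++_; map; filter; length; lookup)
open import Data.List.Extrema.Nat using (max; xs≤max; argmax-sel)
open import Data.List.Membership.Propositional using () renaming (_∈_ to _∈ₗ_)
open import Data.List.Membership.Propositional.Properties
  using (∈-++⁺ˡ; ∈-++⁺ʳ; ∈-map⁺; ∈-map⁻; ∈-filter⁺; ∈-filter⁻)
open import Data.List.NonEmpty.Base using (List⁺; toList)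
open import Data.List.Relation.Unary.All as All using (All)
open import Data.List.Relation.Unary.Any using (here)
open import Data.List.Relation.Unary.Linked using (Linked)
open import Data.List.Relation.Unary.Unique.Propositional using (Unique)
open import Data.Nat.Base using (ℕ; zero; suc; _≤_)
open import Data.Product using (∃; ∃!; _×_; _,_; proj₁; proj₂)
open import Data.Sum.Base using (_⊎_; inj₁; inj₂)
open import Data.Vec.Base using ([]; _∷_)
open import Function.Base using (id)
open import Level using (0ℓ)
open import Relation.Binary.Core using (Rel)
open import Relation.Binary.Definitions using (Decidable)
open import Relation.Binary.PropositionalEquality
  using (_≡_; refl; sym; trans)
open import Relation.Nullary.Decidable
  using (Dec; _×-dec_; _⊎-dec_; _→-dec_; ¬?)
open import Relation.Nullary.Negation.Core using (¬_; contradiction)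

-- The vertex set is a subset of an ambient Fin n, so that a digraph and
-- its induced subdigraphs name their vertices in the same way.
record Digraph (n : ℕ) : Set₁ where
  field
    V         : Subset n
    Edge      : Rel (Fin n) 0ℓ
    edge?     : Decidable Edge
    endpoints : ∀ {u v} → Edge u v → u ∈ V × v ∈ V
    loopless  : ∀ {v} → ¬ Edge v v

open Digraph public

-- Intended for U ⊆ V D.
induced : ∀ {n} → Digraph n → Subset n → Digraph n
induced D U = record
  { V         = U
  ; Edge      = λ u v → Edge D u v × u ∈ U × v ∈ U
  ; edge?     = λ u v → edge? D u v ×-dec (u ∈? U) ×-dec (v ∈? U)
  ; endpoints = proj₂
  ; loopless  = λ e → loopless D (proj₁ e)
  }

module _ {n : ℕ} (D : Digraph n) where

  Adjacent : Rel (Fin n) 0ℓ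
  Adjacent u v = Edge D u v ⊎ Edge D v u

  Stable : Subset n → Set
  Stable S = S ⊆ V D × (∀ u v → u ∈ S → v ∈ S → ¬ Adjacent u v)

  stable? : ∀ S → Dec (Stable S)
  stable? S = (S ⊆? V D) ×-dec
    all? λ u → all? λ v → (u ∈? S) →-dec (v ∈? S) →-dec
      ¬? (edge? D u v ⊎-dec edge? D v u)

subsets : ∀ n → List (Subset n)
subsets zero    = [] ∷ []
subsets (suc n) = map (outside ∷_) (subsets n) ++ map (inside ∷_) (subsets n)

α : ∀ {n} → Digraph n → ℕ
α {n} D = max 0 (map ∣_∣ (filter (stable? D) (subsets n)))

module _ {n : ℕ} (D : Digraph n) where

  MaximumStable : Subset n → Set
  MaximumStable S = Stable D S × ∣ S ∣ ≡ α D

  record Path : Set where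
    field
      vertices : List⁺ (Fin n)
      inV      : All (_∈ V D) (toList vertices)
      linked   : Linked (Edge D) (toList vertices)
      distinct : Unique (toList vertices)

    vertexSet : Subset n
    vertexSet = ⋃ (map ⁅_⁆ (toList vertices))

  open Path public using (vertexSet)

  -- Uniqueness of the position (rather than of the path) also rules out
  -- repeated entries, so such a list is a set of paths.
  PathPartition : List Path → Set
  PathPartition 𝒫 =
    ∀ v → v ∈ V D → ∃! _≡_ λ (i : Fin (length 𝒫)) → v ∈ vertexSet (lookup 𝒫 i)

  Orthogonal : Subset n → List Path → Set
  Orthogonal S 𝒫 = All (λ P → ∣ vertexSet P ∩ S ∣ ≡ 1) 𝒫

  αProperty : Set
  αProperty = ∀ S → MaximumStable S → ∃ λ 𝒫 → PathPartition 𝒫 × Orthogonal S 𝒫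

subsets-complete : ∀ {n} (S : Subset n) → S ∈ₗ subsets n
subsets-complete []          = here refl
subsets-complete (false ∷ S) = ∈-++⁺ˡ (∈-map⁺ (outside ∷_) (subsets-complete S))
subsets-complete {suc n} (true ∷ S) =
  ∈-++⁺ʳ (map (outside ∷_) (subsets n)) (∈-map⁺ (inside ∷_) (subsets-complete S))

module _ {n : ℕ} (D : Digraph n) where

  stable⇒∣S∣≤α : ∀ S → Stable D S → ∣ S ∣ ≤ α D
  stable⇒∣S∣≤α S st = All.lookup (xs≤max 0 _)
    (∈-map⁺ ∣_∣ (∈-filter⁺ (stable? D) (subsets-complete S) st))

  maximumStable-exists : ∃ (MaximumStable D)
  maximumStable-exists
    with argmax-sel id 0 (map ∣_∣ (filter (stable? D) (subsets n)))
  ... | inj₁ α≡0 = ⊥ ,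
    ((λ x∈⊥ → contradiction x∈⊥ ∉⊥) , λ _ _ u∈⊥ → contradiction u∈⊥ ∉⊥) ,
    trans (∣⊥∣≡0 n) (sym α≡0)
  ... | inj₂ α∈ with ∈-map⁻ ∣_∣ α∈
  ...   | S , S∈ , α≡∣S∣ = S , proj₂ (∈-filter⁻ (stable? D) {xs = subsets n} S∈) , sym α≡∣S∣

{-# OPTIONS --safe #-}

-- Write T = V ∖ S and N(X) for the set of neighbours of X on the other side
-- of the bipartition S, T.  The hypothesis says |N(S)| ≤ |S|.  Shrink S to a
-- minimal nonempty Y with |N(Y)| ≤ |Y|.  If some X ⊆ N(Y) violated Hall's
-- condition into Y, then Y ∖ N(X) would be a smaller such set; so N(Y) is
-- matched into Y, and Y ∪ N(Y) splits into edges and single vertices of Y.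
-- Every stable set of the rest stays stable together with Y, so S ∖ Y is
-- maximum there and the rest is partitioned by hypothesis.
module Submission where

open import Defs
open import Data.Bool.Base using (true; false)
open import Data.Fin.Base using (Fin; zero; suc)
open import Data.Fin.Properties using (any?; suc-injective; ¬Fin0)
open import Data.Fin.Subset
  using (Subset; _∈_; _∉_; _⊆_; _⊂_; _∩_; _∪_; _─_; ⋃; ⁅_⁆; ∣_∣; Nonempty; Empty)
open import Data.Fin.Subset.Induction using (⊂-wellFounded)
open import Data.Fin.Subset.Properties
open import Data.List.Base using (List; []; _∷_; map; length; lookup)
open import Data.List.Membership.Propositional using () renaming (_∈_ to _∈ₗ_)
open import Data.List.NonEmpty.Base using (_∷_)
open import Data.List.Relation.Unary.All as All using (All; []; _∷_)
open import Data.List.Relation.Unary.AllPairs using ([]; _∷_)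
open import Data.List.Relation.Unary.Any using (here; there)
open import Data.List.Relation.Unary.Linked as Linked using ([-]; _∷_)
open import Data.Nat using (ℕ; _≤_; _<_; _*_; _+_; _≤?_; _<?_; z≤n)
open import Data.Nat.Properties
  using (+-suc; +-identityʳ; +-monoˡ-≤; +-monoʳ-≤; +-monoʳ-<; +-cancelʳ-≤;
         +-cancelˡ-≤; +-cancelʳ-<; ≤-reflexive; ≤-trans; ≤-antisym; <⇒≤; ≰⇒>; ≮⇒≥; m≤m+n;
         m<n⇒0<n; n≮0; module ≤-Reasoning)
open import Data.Product using (∃; ∃!; _×_; _,_; proj₁; proj₂)
open import Data.Sum.Base as Sum using (_⊎_; inj₁; inj₂; swap; [_,_]′)
open import Data.Vec.Base using ([]; _∷_; tabulate; here; there)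
open import Data.Vec.Properties using ([]=⇒lookup; lookup⇒[]=; lookup∘tabulate)
open import Induction.WellFounded using (Acc; acc)
open import Relation.Binary.PropositionalEquality
  using (_≡_; refl; sym; trans; cong; subst)
open import Relation.Nullary.Decidable
  using (Dec; does; yes; no; dec-true; _×-dec_; _⊎-dec_; decidable-stable)
open import Relation.Nullary.Negation.Core using (¬_; contradiction)
open import Relation.Unary using (Pred; Decidable)

-- Subsets from decidable predicates, and counting in unions and differences.

module _ {n : ℕ} {ℓ} {P : Pred (Fin n) ℓ} (P? : Decidable P) where

  ⟦_⟧ : Subset n
  ⟦_⟧ = tabulate λ v → does (P? v)

  ∈⟦⟧⁺ : ∀ {v} → P v → v ∈ ⟦_⟧
  ∈⟦⟧⁺ {v} pv =
    lookup⇒[]= v ⟦_⟧ (trans (lookup∘tabulate _ v) (dec-true (P? v) pv))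

  ∈⟦⟧⁻ : ∀ {v} → v ∈ ⟦_⟧ → P v
  ∈⟦⟧⁻ {v} v∈ with P? v | trans (sym (lookup∘tabulate (λ w → does (P? w)) v)) ([]=⇒lookup v∈)
  ... | yes pv | _ = pv
  ... | no _   | ()

x∈p─q⇒x∉q : ∀ {n} {x : Fin n} (p q : Subset n) → x ∈ p ─ q → x ∉ q
x∈p─q⇒x∉q (_ ∷ p) (true  ∷ q) (there x∈) (there x∈q) = x∈p─q⇒x∉q p q x∈ x∈q
x∈p─q⇒x∉q (_ ∷ p) (false ∷ q) (there x∈) (there x∈q) = x∈p─q⇒x∉q p q x∈ x∈q

∣p∪q∣+∣p∩q∣≡∣p∣+∣q∣ : ∀ {n} (p q : Subset n) → ∣ p ∪ q ∣ + ∣ p ∩ q ∣ ≡ ∣ p ∣ + ∣ q ∣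
∣p∪q∣+∣p∩q∣≡∣p∣+∣q∣ []          []          = refl
∣p∪q∣+∣p∩q∣≡∣p∣+∣q∣ (false ∷ p) (false ∷ q) = ∣p∪q∣+∣p∩q∣≡∣p∣+∣q∣ p q
∣p∪q∣+∣p∩q∣≡∣p∣+∣q∣ (true  ∷ p) (false ∷ q) = cong ℕ.suc (∣p∪q∣+∣p∩q∣≡∣p∣+∣q∣ p q)
∣p∪q∣+∣p∩q∣≡∣p∣+∣q∣ (false ∷ p) (true  ∷ q) =
  trans (cong ℕ.suc (∣p∪q∣+∣p∩q∣≡∣p∣+∣q∣ p q)) (sym (+-suc ∣ p ∣ ∣ q ∣))
∣p∪q∣+∣p∩q∣≡∣p∣+∣q∣ (true  ∷ p) (true  ∷ q) = cong ℕ.suc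
  (trans (+-suc ∣ p ∪ q ∣ ∣ p ∩ q ∣)
    (trans (cong ℕ.suc (∣p∪q∣+∣p∩q∣≡∣p∣+∣q∣ p q)) (sym (+-suc ∣ p ∣ ∣ q ∣))))

module _ {n : ℕ} where

  Empty⇒∣p∣≡0 : ∀ {p : Subset n} → Empty p → ∣ p ∣ ≡ 0
  Empty⇒∣p∣≡0 ¬∃ = trans (cong ∣_∣ (Empty-unique ¬∃)) (∣⊥∣≡0 n)

  0<∣p∣⇒Nonempty : ∀ {p : Subset n} → 0 < ∣ p ∣ → Nonempty p
  0<∣p∣⇒Nonempty {p} 0<∣p∣ = decidable-stable (nonempty? p) λ ¬∃ →
    n≮0 (subst (0 <_) (Empty⇒∣p∣≡0 ¬∃) 0<∣p∣)

  ∣p∪q∣≤∣p∣+∣q∣ : ∀ (p q : Subset n) → ∣ p ∪ q ∣ ≤ ∣ p ∣ + ∣ q ∣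
  ∣p∪q∣≤∣p∣+∣q∣ p q = ≤-trans (m≤m+n _ ∣ p ∩ q ∣) (≤-reflexive (∣p∪q∣+∣p∩q∣≡∣p∣+∣q∣ p q))

  disjoint⇒∣p∣+∣q∣≤∣p∪q∣ : ∀ {p q : Subset n} → (∀ {v} → v ∈ p → v ∉ q) →
    ∣ p ∣ + ∣ q ∣ ≤ ∣ p ∪ q ∣
  disjoint⇒∣p∣+∣q∣≤∣p∪q∣ {p} {q} p#q = ≤-reflexive (trans (sym (∣p∪q∣+∣p∩q∣≡∣p∣+∣q∣ p q))
    (trans (cong (∣ p ∪ q ∣ +_) (Empty⇒∣p∣≡0 p∩q-empty)) (+-identityʳ _)))
    where
    p∩q-empty : Empty (p ∩ q)
    p∩q-empty (_ , v∈) with x∈p∩q⁻ p q v∈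
    ... | v∈p , v∈q = p#q v∈p v∈q

  ∣p∣≤∣p─q∣+∣q∣ : ∀ (p q : Subset n) → ∣ p ∣ ≤ ∣ p ─ q ∣ + ∣ q ∣
  ∣p∣≤∣p─q∣+∣q∣ p q = ≤-trans (p⊆q⇒∣p∣≤∣q∣ p⊆) (∣p∪q∣≤∣p∣+∣q∣ (p ─ q) q)
    where
    p⊆ : p ⊆ (p ─ q) ∪ q
    p⊆ {v} v∈p with v ∈? q
    ... | yes v∈q = x∈p∪q⁺ (inj₂ v∈q)
    ... | no  v∉q = x∈p∪q⁺ (inj₁ (x∈p∧x∉q⇒x∈p─q v∈p v∉q))

  only⇒∣p∣≡1 : ∀ {p : Subset n} {s} → s ∈ p → (∀ {v} → v ∈ p → v ≡ s) → ∣ p ∣ ≡ 1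
  only⇒∣p∣≡1 {p} {s} s∈p only = trans (cong ∣_∣ (⊆-antisym
    (λ v∈p → subst (_∈ ⁅ s ⁆) (sym (only v∈p)) (x∈⁅x⁆ s))
    (λ v∈s → subst (_∈ p) (sym (x∈⁅y⁆⇒x≡y s v∈s)) s∈p))) (∣⁅x⁆∣≡1 s)

  ∈⋃⁅⁆⁺ : ∀ {v} (vs : List (Fin n)) → v ∈ₗ vs → v ∈ ⋃ (map ⁅_⁆ vs)
  ∈⋃⁅⁆⁺ (w ∷ vs) (here refl) = x∈p∪q⁺ (inj₁ (x∈⁅x⁆ w))
  ∈⋃⁅⁆⁺ (w ∷ vs) (there v∈)  = x∈p∪q⁺ (inj₂ (∈⋃⁅⁆⁺ vs v∈))

  ∈⋃⁅⁆⁻ : ∀ {v} (vs : List (Fin n)) → v ∈ ⋃ (map ⁅_⁆ vs) → v ∈ₗ vs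
  ∈⋃⁅⁆⁻ []       v∈ = contradiction v∈ ∉⊥
  ∈⋃⁅⁆⁻ (w ∷ vs) v∈ with x∈p∪q⁻ ⁅ w ⁆ _ v∈
  ... | inj₁ v∈w  = here (x∈⁅y⁆⇒x≡y w v∈w)
  ... | inj₂ v∈vs = there (∈⋃⁅⁆⁻ vs v∈vs)

-- Paths on one or two vertices, and neighbourhoods.

module _ {n : ℕ} (D : Digraph n) where

  adjacent? : ∀ u v → Dec (Adjacent D u v)
  adjacent? u v = edge? D u v ⊎-dec edge? D v u

  vertexSet⊆V : ∀ (P : Path D) → vertexSet P ⊆ V D
  vertexSet⊆V P v∈P = All.lookup (Path.inV P) (∈⋃⁅⁆⁻ _ v∈P)

  induced-path : ∀ {U} → U ⊆ V D → Path (induced D U) → Path D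
  induced-path U⊆V P = record
    { vertices = Path.vertices P
    ; inV      = All.map U⊆V (Path.inV P)
    ; linked   = Linked.map proj₁ (Path.linked P)
    ; distinct = Path.distinct P
    }

  vertex-path : ∀ {s} → s ∈ V D → Path D
  vertex-path {s} s∈V = record
    { vertices = s ∷ [] ; inV = s∈V ∷ [] ; linked = [-] ; distinct = [] ∷ [] }

  edge-path : ∀ {u v} → Edge D u v → Path D
  edge-path {u} {v} e = record
    { vertices = u ∷ v ∷ []
    ; inV      = proj₁ (endpoints D e) ∷ proj₂ (endpoints D e) ∷ []
    ; linked   = e ∷ [-]
    ; distinct = ((λ { refl → loopless D e }) ∷ []) ∷ [] ∷ []
    }

  -- Orthogonality looks at vertex sets only, so the direction of the edge can be forgotten from
  -- here on.
  adjacent-path : ∀ {u v} → Adjacent D u v → ∃ λ (P : Path D) →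
    u ∈ vertexSet P × v ∈ vertexSet P × (∀ {w} → w ∈ vertexSet P → w ≡ u ⊎ w ≡ v)
  adjacent-path {u} {v} (inj₁ e) =
    edge-path e , ∈⋃⁅⁆⁺ (u ∷ v ∷ []) (here refl) , ∈⋃⁅⁆⁺ (u ∷ v ∷ []) (there (here refl)) , ends
    where
    ends : ∀ {w} → w ∈ vertexSet (edge-path e) → w ≡ u ⊎ w ≡ v
    ends w∈ with ∈⋃⁅⁆⁻ (u ∷ v ∷ []) w∈
    ... | here w≡u         = inj₁ w≡u
    ... | there (here w≡v) = inj₂ w≡v
  adjacent-path (inj₂ e) with adjacent-path (inj₁ e)
  ... | P , v∈ , u∈ , ends = P , u∈ , v∈ , λ w∈ → swap (ends w∈)

  neighbour? : ∀ A X v → Dec (v ∈ A × ∃ λ x → x ∈ X × Adjacent D x v)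
  neighbour? A X v = (v ∈? A) ×-dec any? λ x → (x ∈? X) ×-dec adjacent? x v

  neighbours : Subset n → Subset n → Subset n
  neighbours A X = ⟦ neighbour? A X ⟧

  ∈neighbours⁺ : ∀ {A X v x} → v ∈ A → x ∈ X → Adjacent D x v → v ∈ neighbours A X
  ∈neighbours⁺ {A} {X} v∈A x∈X x~v = ∈⟦⟧⁺ (neighbour? A X) (v∈A , _ , x∈X , x~v)

  ∈neighbours⁻ : ∀ A X {v} → v ∈ neighbours A X → v ∈ A × ∃ λ x → x ∈ X × Adjacent D x v
  ∈neighbours⁻ A X = ∈⟦⟧⁻ (neighbour? A X)

-- Path partitions of a vertex set, peeled off one path at a time.

module _ {n : ℕ} (D : Digraph n) (S : Subset n) where

  -- Each path is deleted from `W` before the next is chosen, so disjointness is built in and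
  -- partitions combine without handling positions in a list.
  data Partitionable (W : Subset n) : Set where
    nil  : Empty W → Partitionable W
    cons : (P : Path D) → vertexSet P ⊆ W → ∣ vertexSet P ∩ S ∣ ≡ 1 →
           Partitionable (W ─ vertexSet P) → Partitionable W

  -- Induction on the partition of `A`: since its first path `p` lies in `A`, `W ─ A` equals
  -- `(W ─ p) ─ (A ─ p)`, and the same remainder serves the shorter partition.
  join : ∀ {A W} → A ⊆ W → Partitionable A → Partitionable (W ─ A) → Partitionable W
  join {A} {W} A⊆W (nil A-empty) rest = subst Partitionable
    (⊆-antisym (p─q⊆p W A) λ v∈W → x∈p∧x∉q⇒x∈p─q v∈W λ v∈A → A-empty (_ , v∈A)) rest
  join {A} {W} A⊆W (cons P P⊆A orth ps) rest =
    cons P (λ v∈P → A⊆W (P⊆A v∈P)) orth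
      (join A─P⊆W─P ps (subst Partitionable (⊆-antisym to from) rest))
    where
    p = vertexSet P
    A─P⊆W─P : A ─ p ⊆ W ─ p
    A─P⊆W─P v∈ = x∈p∧x∉q⇒x∈p─q (A⊆W (p─q⊆p A p v∈)) (x∈p─q⇒x∉q A p v∈)
    to : W ─ A ⊆ (W ─ p) ─ (A ─ p)
    to v∈ = x∈p∧x∉q⇒x∈p─q
      (x∈p∧x∉q⇒x∈p─q (p─q⊆p W A v∈) (λ v∈P → x∈p─q⇒x∉q W A v∈ (P⊆A v∈P)))
      (λ v∈A─P → x∈p─q⇒x∉q W A v∈ (p─q⊆p A p v∈A─P))
    from : (W ─ p) ─ (A ─ p) ⊆ W ─ A
    from v∈ = x∈p∧x∉q⇒x∈p─q (p─q⊆p W p v∈W─P)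
      (λ v∈A → x∈p─q⇒x∉q (W ─ p) (A ─ p) v∈ (x∈p∧x∉q⇒x∈p─q v∈A (x∈p─q⇒x∉q W p v∈W─P)))
      where v∈W─P = p─q⊆p (W ─ p) (A ─ p) v∈

  -- That all paths stay inside `W` is carried for the induction: later paths then avoid the head,
  -- so `zero` is the only position of its vertices.
  toPaths : ∀ {W} → Partitionable W → ∃ λ (𝒫 : List (Path D)) →
    (∀ v → v ∈ W → ∃! _≡_ λ (i : Fin (length 𝒫)) → v ∈ vertexSet (lookup 𝒫 i)) ×
    (∀ i → vertexSet (lookup 𝒫 i) ⊆ W) ×
    Orthogonal D S 𝒫
  toPaths (nil W-empty) = [] , (λ v v∈W → contradiction (v , v∈W) W-empty) , (λ ()) , []
  toPaths {W} (cons P P⊆W orth ps) with toPaths ps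
  ... | 𝒫 , unique , inside-W─P , orths = P ∷ 𝒫 , unique′ , inside-W , orth ∷ orths
    where
    p = vertexSet P
    inside-W : ∀ i → vertexSet (lookup (P ∷ 𝒫) i) ⊆ W
    inside-W zero    v∈ = P⊆W v∈
    inside-W (suc i) v∈ = p─q⊆p W p (inside-W─P i v∈)
    unique′ : ∀ v → v ∈ W →
      ∃! _≡_ λ (i : Fin (length (P ∷ 𝒫))) → v ∈ vertexSet (lookup (P ∷ 𝒫) i)
    unique′ v v∈W with v ∈? p
    ... | yes v∈P = zero , v∈P , λ
      { {zero}  _  → refl
      ; {suc j} v∈ → contradiction v∈P (x∈p─q⇒x∉q W p (inside-W─P j v∈)) }
    ... | no v∉P with unique v (x∈p∧x∉q⇒x∈p─q v∈W v∉P)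
    ...   | i , v∈ , only = suc i , v∈ , λ
      { {zero}  v∈P → contradiction v∈P v∉P
      ; {suc j} v∈j → cong suc (only v∈j) }

  -- `R` stays fixed while `W` shrinks, so the type of the paths survives the recursion. Uniqueness
  -- of positions makes the head disjoint from the later paths.
  fromPaths : ∀ {R W} → R ⊆ V D → (𝒫 : List (Path (induced D R))) →
    (∀ v → v ∈ W → ∃! _≡_ λ (i : Fin (length 𝒫)) → v ∈ vertexSet (lookup 𝒫 i)) →
    (∀ i → vertexSet (lookup 𝒫 i) ⊆ W) →
    All (λ P → ∣ vertexSet P ∩ S ∣ ≡ 1) 𝒫 → Partitionable W
  fromPaths _ [] unique _ _ = nil λ { (v , v∈W) → ¬Fin0 (proj₁ (unique v v∈W)) }
  fromPaths {W = W} R⊆V (P ∷ 𝒫) unique inside-W (orth ∷ orths) =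
    cons (induced-path D R⊆V P) (inside-W zero) orth (fromPaths R⊆V 𝒫 unique′ inside-W─P orths)
    where
    p = vertexSet P
    unique′ : ∀ v → v ∈ W ─ p →
      ∃! _≡_ λ (i : Fin (length 𝒫)) → v ∈ vertexSet (lookup 𝒫 i)
    unique′ v v∈ with unique v (p─q⊆p W p v∈)
    ... | zero  , v∈P , _    = contradiction v∈P (x∈p─q⇒x∉q W p v∈)
    ... | suc i , v∈i , only = i , v∈i , λ v∈j → suc-injective (only v∈j)
    inside-W─P : ∀ i → vertexSet (lookup 𝒫 i) ⊆ W ─ p
    inside-W─P i {v} v∈i = x∈p∧x∉q⇒x∈p─q v∈W v∉P
      where
      v∈W = inside-W (suc i) v∈i
      v∉P : v ∉ p
      v∉P v∈P with unique v v∈W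
      ... | k , _ , only with trans (sym (only {zero} v∈P)) (only {suc i} v∈i)
      ...   | ()

  -- Hall's theorem for matching `W ─ S` into `W ∩ S`.

  Hall : Subset n → Set
  Hall W = ∀ X → X ⊆ W ─ S → ∣ X ∣ ≤ ∣ neighbours D (W ∩ S) X ∣

  -- The case distinction in Hall's theorem: a tight X splits W into two parts
  -- that both satisfy Hall's condition; without one there is a surplus of 1,
  -- so any edge can be removed.
  Tight : Subset n → Subset n → Set
  Tight W X = X ⊆ W ─ S × Nonempty X × Nonempty ((W ─ S) ─ X) ×
    ∣ neighbours D (W ∩ S) X ∣ ≤ ∣ X ∣

  tight? : ∀ W X → Dec (Tight W X)
  tight? W X = (X ⊆? (W ─ S)) ×-dec nonempty? X ×-dec nonempty? ((W ─ S) ─ X) ×-dec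
    (∣ neighbours D (W ∩ S) X ∣ ≤? ∣ X ∣)

  module _ {W X : Subset n} (tight : Tight W X) where

    private
      N  = neighbours D (W ∩ S) X
      U  = X ∪ N
      X⊆ = proj₁ tight

    X⊆W : X ⊆ W
    X⊆W v∈X = p─q⊆p W S (X⊆ v∈X)

    N⊆W∩S : N ⊆ W ∩ S
    N⊆W∩S v∈N = proj₁ (∈neighbours⁻ D (W ∩ S) X v∈N)

    block⊆W : U ⊆ W
    block⊆W v∈U = [ X⊆W , (λ v∈N → p∩q⊆p W S (N⊆W∩S v∈N)) ]′ (x∈p∪q⁻ X N v∈U)

    block∖S⊆X : ∀ {v} → v ∈ U → v ∉ S → v ∈ X
    block∖S⊆X v∈U v∉S with x∈p∪q⁻ X N v∈U
    ... | inj₁ v∈X = v∈X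
    ... | inj₂ v∈N = contradiction (p∩q⊆q W S (N⊆W∩S v∈N)) v∉S

    -- The nonemptiness conditions of `Tight` make the recursion descend: a vertex outside both `S`
    -- and `X` keeps the block proper, and a vertex of `X` keeps the rest proper.
    block⊂W : U ⊂ W
    block⊂W = block⊆W , z , p─q⊆p W S z∈W─S ,
      λ z∈U → x∈p─q⇒x∉q (W ─ S) X z∈ (block∖S⊆X z∈U (x∈p─q⇒x∉q W S z∈W─S))
      where
      z  = proj₁ (proj₁ (proj₂ (proj₂ tight)))
      z∈ = proj₂ (proj₁ (proj₂ (proj₂ tight)))
      z∈W─S = p─q⊆p (W ─ S) X z∈

    rest⊂W : W ─ U ⊂ W
    rest⊂W = p∩q≢∅⇒p─q⊂p W U (x , x∈p∩q⁺ (X⊆W x∈X , x∈p∪q⁺ (inj₁ x∈X)))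
      where
      x   = proj₁ (proj₁ (proj₂ tight))
      x∈X = proj₂ (proj₁ (proj₂ tight))

    -- Neighbours of a subset of `X` lie in `N`, which belongs to the block, so none are lost.
    hall-block : Hall W → Hall U
    hall-block hall X′ X′⊆ = ≤-trans (hall X′ λ v∈ → X⊆ (X′⊆X v∈)) (p⊆q⇒∣p∣≤∣q∣ N⊆)
      where
      X′⊆X : X′ ⊆ X
      X′⊆X v∈ = block∖S⊆X (p─q⊆p U S (X′⊆ v∈)) (x∈p─q⇒x∉q U S (X′⊆ v∈))
      N⊆ : neighbours D (W ∩ S) X′ ⊆ neighbours D (U ∩ S) X′
      N⊆ v∈ with ∈neighbours⁻ D (W ∩ S) X′ v∈
      ... | v∈W∩S , _ , x∈X′ , x~v = ∈neighbours⁺ D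
        (x∈p∩q⁺ (x∈p∪q⁺ (inj₂ (∈neighbours⁺ D v∈W∩S (X′⊆X x∈X′) x~v)) , p∩q⊆q W S v∈W∩S))
        x∈X′ x~v

    -- Hall's condition is applied to `X ∪ X′`: a neighbour outside `N` comes from `X′` and survives
    -- in the rest, and tightness then lets `∣ X ∣` be cancelled.
    hall-rest : Hall W → Hall (W ─ U)
    hall-rest hall X′ X′⊆ = +-cancelˡ-≤ ∣ X ∣ _ _ (begin
      ∣ X ∣ + ∣ X′ ∣                     ≤⟨ disjoint⇒∣p∣+∣q∣≤∣p∪q∣ X#X′ ⟩
      ∣ X ∪ X′ ∣                         ≤⟨ hall (X ∪ X′) X∪X′⊆ ⟩
      ∣ neighbours D (W ∩ S) (X ∪ X′) ∣  ≤⟨ p⊆q⇒∣p∣≤∣q∣ N⊆ ⟩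
      ∣ N ∪ N′ ∣                         ≤⟨ ∣p∪q∣≤∣p∣+∣q∣ N N′ ⟩
      ∣ N ∣ + ∣ N′ ∣                     ≤⟨ +-monoˡ-≤ ∣ N′ ∣ (proj₂ (proj₂ (proj₂ tight))) ⟩
      ∣ X ∣ + ∣ N′ ∣                     ∎)
      where
      open ≤-Reasoning
      N′ = neighbours D ((W ─ U) ∩ S) X′
      X′⊆W─U : X′ ⊆ W ─ U
      X′⊆W─U v∈ = p─q⊆p (W ─ U) S (X′⊆ v∈)
      X#X′ : ∀ {v} → v ∈ X → v ∉ X′
      X#X′ v∈X v∈X′ = x∈p─q⇒x∉q W U (X′⊆W─U v∈X′) (x∈p∪q⁺ (inj₁ v∈X))
      X∪X′⊆ : X ∪ X′ ⊆ W ─ S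
      X∪X′⊆ v∈ with x∈p∪q⁻ X X′ v∈
      ... | inj₁ v∈X  = X⊆ v∈X
      ... | inj₂ v∈X′ = x∈p∧x∉q⇒x∈p─q (p─q⊆p W U (X′⊆W─U v∈X′)) (x∈p─q⇒x∉q (W ─ U) S (X′⊆ v∈X′))
      N⊆ : neighbours D (W ∩ S) (X ∪ X′) ⊆ N ∪ N′
      N⊆ {v} v∈ with ∈neighbours⁻ D (W ∩ S) (X ∪ X′) v∈ | v ∈? N
      ... | _ | yes v∈N = x∈p∪q⁺ (inj₁ v∈N)
      ... | v∈W∩S , x , x∈ , x~v | no v∉N with x∈p∪q⁻ X X′ x∈
      ...   | inj₁ x∈X  = contradiction (∈neighbours⁺ D v∈W∩S x∈X x~v) v∉N
      ...   | inj₂ x∈X′ = x∈p∪q⁺ (inj₂ (∈neighbours⁺ D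
                (x∈p∩q⁺ (x∈p∧x∉q⇒x∈p─q (p∩q⊆p W S v∈W∩S) v∉U , p∩q⊆q W S v∈W∩S)) x∈X′ x~v))
        where
        v∉U : v ∉ U
        v∉U v∈U = [ (λ v∈X → x∈p─q⇒x∉q W S (X⊆ v∈X) (p∩q⊆q W S v∈W∩S)) , v∉N ]′ (x∈p∪q⁻ X N v∈U)

  -- The vertex is named rather than counted, since it is what the `S` side loses when the path is
  -- removed.
  Meets-only : Subset n → Fin n → Set
  Meets-only p s = s ∈ p × s ∈ S × (∀ {v} → v ∈ p → v ∈ S → v ≡ s)

  meets-only⇒∣p∩S∣≡1 : ∀ {p s} → Meets-only p s → ∣ p ∩ S ∣ ≡ 1
  meets-only⇒∣p∩S∣≡1 {p} (s∈p , s∈S , only) =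
    only⇒∣p∣≡1 (x∈p∩q⁺ (s∈p , s∈S)) λ v∈ → only (p∩q⊆p p S v∈) (p∩q⊆q p S v∈)

  -- Deleting `p` takes only `s` from the `S` side, so a neighbourhood shrinks by at most one, and
  -- the surplus pays for it.
  hall-─ : ∀ {W p s} → Meets-only p s →
    (∀ X → X ⊆ (W ─ p) ─ S → Nonempty X → ∣ X ∣ < ∣ neighbours D (W ∩ S) X ∣) →
    Hall (W ─ p)
  hall-─ {W} {p} {s} (_ , _ , only) surplus X X⊆ = bound (nonempty? X)
    where
    open ≤-Reasoning
    N′ = neighbours D ((W ─ p) ∩ S) X
    N⊆ : neighbours D (W ∩ S) X ⊆ ⁅ s ⁆ ∪ N′
    N⊆ {v} v∈ with ∈neighbours⁻ D (W ∩ S) X v∈ | v ∈? p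
    ... | v∈W∩S , _ | yes v∈p = x∈p∪q⁺ (inj₁
            (subst (_∈ ⁅ s ⁆) (sym (only v∈p (p∩q⊆q W S v∈W∩S))) (x∈⁅x⁆ s)))
    ... | v∈W∩S , _ , x∈X , x~v | no v∉p = x∈p∪q⁺ (inj₂ (∈neighbours⁺ D
            (x∈p∩q⁺ (x∈p∧x∉q⇒x∈p─q (p∩q⊆p W S v∈W∩S) v∉p , p∩q⊆q W S v∈W∩S)) x∈X x~v))
    bound : Dec (Nonempty X) → ∣ X ∣ ≤ ∣ N′ ∣
    bound (no X-empty)     = ≤-trans (≤-reflexive (Empty⇒∣p∣≡0 X-empty)) z≤n
    bound (yes X-nonempty) = +-cancelˡ-≤ 1 ∣ X ∣ ∣ N′ ∣ (begin
      1 + ∣ X ∣                   ≤⟨ surplus X X⊆ X-nonempty ⟩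
      ∣ neighbours D (W ∩ S) X ∣  ≤⟨ p⊆q⇒∣p∣≤∣q∣ N⊆ ⟩
      ∣ ⁅ s ⁆ ∪ N′ ∣              ≤⟨ ∣p∪q∣≤∣p∣+∣q∣ ⁅ s ⁆ N′ ⟩
      ∣ ⁅ s ⁆ ∣ + ∣ N′ ∣          ≡⟨ cong (_+ ∣ N′ ∣) (∣⁅x⁆∣≡1 s) ⟩
      1 + ∣ N′ ∣                  ∎)

  ∃-vertex-path : ∀ {W s} → W ⊆ V D → s ∈ W → s ∈ S → ∃ λ (P : Path D) →
    s ∈ vertexSet P × vertexSet P ⊆ W × ∃ (Meets-only (vertexSet P))
  ∃-vertex-path {W} {s} W⊆V s∈W s∈S =
    P , s∈P , (λ v∈P → subst (_∈ W) (sym (only v∈P)) s∈W) , s , s∈P , s∈S , λ v∈P _ → only v∈P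
    where
    P = vertex-path D (W⊆V s∈W)
    s∈P : s ∈ vertexSet P
    s∈P = ∈⋃⁅⁆⁺ (s ∷ []) (here refl)
    only : ∀ {v} → v ∈ vertexSet P → v ≡ s
    only v∈P with ∈⋃⁅⁆⁻ (s ∷ []) v∈P
    ... | here v≡s = v≡s

  -- Hall's condition for `⁅ t ⁆` supplies a neighbour of `t` in `W ∩ S`.
  ∃-edge-path : ∀ {W t} → Hall W → t ∈ W ─ S → ∃ λ (P : Path D) →
    t ∈ vertexSet P × vertexSet P ⊆ W × ∃ (Meets-only (vertexSet P))
  ∃-edge-path {W} {t} hall t∈W─S
    with 0<∣p∣⇒Nonempty (≤-trans (≤-reflexive (sym (∣⁅x⁆∣≡1 t)))
      (hall ⁅ t ⁆ λ v∈ → subst (_∈ W ─ S) (sym (x∈⁅y⁆⇒x≡y t v∈)) t∈W─S))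
  ... | s , s∈N with ∈neighbours⁻ D (W ∩ S) ⁅ t ⁆ s∈N
  ... | s∈W∩S , x , x∈⁅t⁆ , x~s with x∈⁅y⁆⇒x≡y t x∈⁅t⁆
  ... | refl with adjacent-path D x~s
  ... | P , t∈P , s∈P , ends = P , t∈P , P⊆W , s , s∈P , p∩q⊆q W S s∈W∩S , only
    where
    P⊆W : vertexSet P ⊆ W
    P⊆W v∈P with ends v∈P
    ... | inj₁ refl = p─q⊆p W S t∈W─S
    ... | inj₂ refl = p∩q⊆p W S s∈W∩S
    only : ∀ {v} → v ∈ vertexSet P → v ∈ S → v ≡ s
    only v∈P v∈S with ends v∈P
    ... | inj₁ refl = contradiction v∈S (x∈p─q⇒x∉q W S t∈W─S)
    ... | inj₂ v≡s  = v≡s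

  -- Well-founded induction on `W`. Inside `S`, single vertices are peeled off; a tight set splits
  -- `W` in two; without one, an edge joining some `t` outside `S` to `S` is peeled off.
  hall⇒partitionable : ∀ {W} → Acc _⊂_ W → W ⊆ V D → Hall W → Partitionable W
  hall⇒partitionable {W} (acc rec) W⊆V hall = split (nonempty? (W ─ S))
    where
    extend : ∀ {v} (P : Path D) →
      v ∈ vertexSet P × vertexSet P ⊆ W × ∃ (Meets-only (vertexSet P)) →
      (∀ X → X ⊆ (W ─ vertexSet P) ─ S → Nonempty X → ∣ X ∣ < ∣ neighbours D (W ∩ S) X ∣) →
      Partitionable W
    extend P (v∈P , P⊆W , _ , meets) surplus =
      cons P P⊆W (meets-only⇒∣p∩S∣≡1 meets)
        (hall⇒partitionable
          (rec (p∩q≢∅⇒p─q⊂p W (vertexSet P) (_ , x∈p∩q⁺ (P⊆W v∈P , v∈P))))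
          (λ v∈ → W⊆V (p─q⊆p W (vertexSet P) v∈)) (hall-─ meets surplus))

    ──⊆ : ∀ {p X} → X ⊆ (W ─ p) ─ S → X ⊆ W ─ S
    ──⊆ {p} X⊆ v∈ = x∈p∧x∉q⇒x∈p─q
      (p─q⊆p W p (p─q⊆p (W ─ p) S (X⊆ v∈))) (x∈p─q⇒x∉q (W ─ p) S (X⊆ v∈))

    within-S : Empty (W ─ S) → Dec (Nonempty W) → Partitionable W
    within-S _ (no W-empty) = nil W-empty
    within-S W─S-empty (yes (w , w∈W)) with ∃-vertex-path W⊆V w∈W
      (decidable-stable (w ∈? S) λ w∉S → W─S-empty (w , x∈p∧x∉q⇒x∈p─q w∈W w∉S))
    ... | P , props = extend P props
      λ { _ X⊆ (x , x∈X) → contradiction (x , ──⊆ X⊆ x∈X) W─S-empty }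

    beyond-S : ∀ {t} → t ∈ W ─ S → Dec (∃ (Tight W)) → Partitionable W
    beyond-S _ (yes (X , tight)) = join (block⊆W tight)
      (hall⇒partitionable (rec (block⊂W tight))
        (λ v∈ → W⊆V (block⊆W tight v∈)) (hall-block tight hall))
      (hall⇒partitionable (rec (rest⊂W tight))
        (λ v∈ → W⊆V (p─q⊆p W _ v∈)) (hall-rest tight hall))
    beyond-S {t} t∈W─S (no ¬tight) with ∃-edge-path hall t∈W─S
    ... | P , props@(t∈P , _) = extend P props λ X X⊆ X-nonempty →
      -- An `X` without surplus would be tight: it avoids the path, so `t` witnesses that it does
      -- not fill `W ─ S`.
      ≰⇒> λ ∣N∣≤∣X∣ → ¬tight (X , ──⊆ X⊆ , X-nonempty ,
        (t , x∈p∧x∉q⇒x∈p─q t∈W─S λ t∈X →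
          x∈p─q⇒x∉q W (vertexSet P) (p─q⊆p (W ─ vertexSet P) S (X⊆ t∈X)) t∈P) ,
        ∣N∣≤∣X∣)

    split : Dec (Nonempty (W ─ S)) → Partitionable W
    split (no W─S-empty) = within-S W─S-empty (nonempty? W)
    split (yes (_ , t∈)) = beyond-S t∈ (anySubset? (tight? W))

  -- Shrinking `S` to a set whose closure satisfies Hall's condition.

  private
    T = V D ─ S
    N : Subset n → Subset n
    N = neighbours D T

  closure : Subset n → Subset n
  closure Y = Y ∪ N Y

  -- Minimality is replaced by a descent. When the neighbours `M` of a violating `X` leave `Y`, all
  -- of `X` leaves `N Y`; so `N Y` loses at least `∣ X ∣` vertices and `Y` fewer than that.
  ∃-hall-closure : ∀ {Y} → Acc _⊂_ Y → Nonempty Y → Y ⊆ S → ∣ N Y ∣ ≤ ∣ Y ∣ →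
    ∃ λ Y′ → Nonempty Y′ × Y′ ⊆ S × Hall (closure Y′)
  ∃-hall-closure {Y} (acc rec) Y-nonempty Y⊆S ∣NY∣≤∣Y∣
    with anySubset? (λ X → (X ⊆? N Y) ×-dec (∣ neighbours D Y X ∣ <? ∣ X ∣))
  ... | no ¬violator = Y , Y-nonempty , Y⊆S , hall
    where
    hall : Hall (closure Y)
    hall X X⊆ = ≤-trans (≮⇒≥ λ X-violates → ¬violator (X , X⊆NY , X-violates))
      (p⊆q⇒∣p∣≤∣q∣ N⊆)
      where
      X⊆NY : X ⊆ N Y
      X⊆NY v∈X with x∈p∪q⁻ Y (N Y) (p─q⊆p (closure Y) S (X⊆ v∈X))
      ... | inj₁ v∈Y  = contradiction (Y⊆S v∈Y) (x∈p─q⇒x∉q (closure Y) S (X⊆ v∈X))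
      ... | inj₂ v∈NY = v∈NY
      N⊆ : neighbours D Y X ⊆ neighbours D (closure Y ∩ S) X
      N⊆ v∈ with ∈neighbours⁻ D Y X v∈
      ... | v∈Y , _ , x∈X , x~v =
        ∈neighbours⁺ D (x∈p∩q⁺ (x∈p∪q⁺ (inj₁ v∈Y) , Y⊆S v∈Y)) x∈X x~v
  ... | yes (X , X⊆NY , X-violates) =
    -- The new inequality is strict, which also keeps `Y′` nonempty.
    ∃-hall-closure (rec Y′⊂Y) (0<∣p∣⇒Nonempty (m<n⇒0<n ∣NY′∣<∣Y′∣))
      (λ v∈ → Y⊆S (p─q⊆p Y M v∈)) (<⇒≤ ∣NY′∣<∣Y′∣)
    where
    M  = neighbours D Y X
    Y′ = Y ─ M
    ∣NY′∣<∣Y′∣ : ∣ N Y′ ∣ < ∣ Y′ ∣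
    ∣NY′∣<∣Y′∣ = +-cancelʳ-< ∣ X ∣ _ _ (begin-strict
      ∣ N Y′ ∣ + ∣ X ∣  ≤⟨ disjoint⇒∣p∣+∣q∣≤∣p∪q∣ NY′#X ⟩
      ∣ N Y′ ∪ X ∣      ≤⟨ p⊆q⇒∣p∣≤∣q∣ NY′∪X⊆NY ⟩
      ∣ N Y ∣           ≤⟨ ∣NY∣≤∣Y∣ ⟩
      ∣ Y ∣             ≤⟨ ∣p∣≤∣p─q∣+∣q∣ Y M ⟩
      ∣ Y′ ∣ + ∣ M ∣    <⟨ +-monoʳ-< ∣ Y′ ∣ X-violates ⟩
      ∣ Y′ ∣ + ∣ X ∣    ∎)
      where
      open ≤-Reasoning
      NY′#X : ∀ {v} → v ∈ N Y′ → v ∉ X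
      NY′#X v∈ v∈X with ∈neighbours⁻ D T Y′ v∈
      ... | _ , y , y∈Y′ , y~v =
        x∈p─q⇒x∉q Y M y∈Y′ (∈neighbours⁺ D (p─q⊆p Y M y∈Y′) v∈X (swap y~v))
      NY′∪X⊆NY : N Y′ ∪ X ⊆ N Y
      NY′∪X⊆NY v∈ with x∈p∪q⁻ (N Y′) X v∈
      ... | inj₂ v∈X = X⊆NY v∈X
      ... | inj₁ v∈N with ∈neighbours⁻ D T Y′ v∈N
      ...   | v∈T , y , y∈Y′ , y~v = ∈neighbours⁺ D v∈T (p─q⊆p Y M y∈Y′) y~v
    Y′⊂Y : Y′ ⊂ Y
    -- A violating `X` is nonempty and lies in `N Y`, so some `y` in `Y` is adjacent to it and is
    -- removed with `M`.
    Y′⊂Y with 0<∣p∣⇒Nonempty {p = X} (m<n⇒0<n X-violates)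
    ... | x , x∈X with ∈neighbours⁻ D T Y (X⊆NY x∈X)
    ...   | _ , y , y∈Y , y~x =
      p∩q≢∅⇒p─q⊂p Y M (y , x∈p∩q⁺ (y∈Y , ∈neighbours⁺ D y∈Y x∈X (swap y~x)))

  -- These neighbours lie in `T`, and `S` and `T` are disjoint parts of a vertex set of size at most
  -- `2 * ∣ S ∣`.
  ∣NS∣≤∣S∣ : MaximumStable D S → ∣ V D ∣ ≤ 2 * α D → ∣ N S ∣ ≤ ∣ S ∣
  ∣NS∣≤∣S∣ ((S⊆V , _) , ∣S∣≡α) ∣V∣≤2α = +-cancelˡ-≤ ∣ S ∣ _ _ (begin
    ∣ S ∣ + ∣ N S ∣  ≤⟨ +-monoʳ-≤ ∣ S ∣ (p⊆q⇒∣p∣≤∣q∣ λ v∈ → proj₁ (∈neighbours⁻ D T S v∈)) ⟩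
    ∣ S ∣ + ∣ T ∣    ≤⟨ disjoint⇒∣p∣+∣q∣≤∣p∪q∣ (λ v∈S v∈T → x∈p─q⇒x∉q (V D) S v∈T v∈S) ⟩
    ∣ S ∪ T ∣        ≤⟨ p⊆q⇒∣p∣≤∣q∣ (λ v∈ → [ S⊆V , p─q⊆p (V D) S ]′ (x∈p∪q⁻ S T v∈)) ⟩
    ∣ V D ∣          ≤⟨ ∣V∣≤2α ⟩
    2 * α D          ≡⟨ cong (2 *_) (sym ∣S∣≡α) ⟩
    2 * ∣ S ∣        ≡⟨ cong (∣ S ∣ +_) (+-identityʳ ∣ S ∣) ⟩
    ∣ S ∣ + ∣ S ∣    ∎)
    where open ≤-Reasoning

  -- The digraph left after removing the closure of `Y`.

  module _ (maximum : MaximumStable D S) {Y : Subset n} (Y⊆S : Y ⊆ S) where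

    private
      S⊆V = proj₁ (proj₁ maximum)
      S-independent = proj₂ (proj₁ maximum)
      U = closure Y
      R = V D ─ U

    closure⊆V : U ⊆ V D
    closure⊆V v∈U with x∈p∪q⁻ Y (N Y) v∈U
    ... | inj₁ v∈Y  = S⊆V (Y⊆S v∈Y)
    ... | inj₂ v∈NY = p─q⊆p (V D) S (proj₁ (∈neighbours⁻ D T Y v∈NY))

    closure∩S⊆Y : ∀ {v} → v ∈ U → v ∈ S → v ∈ Y
    closure∩S⊆Y v∈U v∈S with x∈p∪q⁻ Y (N Y) v∈U
    ... | inj₁ v∈Y  = v∈Y
    ... | inj₂ v∈NY = contradiction v∈S (x∈p─q⇒x∉q (V D) S (proj₁ (∈neighbours⁻ D T Y v∈NY)))

    remainder-stable : Stable (induced D R) (S ─ Y)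
    remainder-stable =
      (λ v∈ → x∈p∧x∉q⇒x∈p─q (S⊆V (p─q⊆p S Y v∈))
        λ v∈U → x∈p─q⇒x∉q S Y v∈ (closure∩S⊆Y v∈U (p─q⊆p S Y v∈))) ,
      λ u v u∈ v∈ u~v →
        S-independent u v (p─q⊆p S Y u∈) (p─q⊆p S Y v∈) (Sum.map proj₁ proj₁ u~v)

    -- Nothing in `R` that lies outside `S` is adjacent to `Y`, since the closure took all such
    -- neighbours; inside `S`, stability of `S` excludes them.
    stable-∪ : ∀ {Z} → Stable (induced D R) Z → Stable D (Z ∪ Y)
    stable-∪ {Z} (Z⊆R , Z-independent) = Z∪Y⊆V , independent
      where
      Z∪Y⊆V : Z ∪ Y ⊆ V D
      Z∪Y⊆V v∈ with x∈p∪q⁻ Z Y v∈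
      ... | inj₁ v∈Z = p─q⊆p (V D) U (Z⊆R v∈Z)
      ... | inj₂ v∈Y = S⊆V (Y⊆S v∈Y)
      no-cross : ∀ {y z} → y ∈ Y → z ∈ Z → ¬ Adjacent D y z
      no-cross {y} {z} y∈Y z∈Z y~z with z ∈? S
      ... | yes z∈S = S-independent y z (Y⊆S y∈Y) z∈S y~z
      ... | no  z∉S = x∈p─q⇒x∉q (V D) U (Z⊆R z∈Z) (x∈p∪q⁺ (inj₂ (∈neighbours⁺ D
        (x∈p∧x∉q⇒x∈p─q (p─q⊆p (V D) U (Z⊆R z∈Z)) z∉S) y∈Y y~z)))
      independent : ∀ u v → u ∈ Z ∪ Y → v ∈ Z ∪ Y → ¬ Adjacent D u v
      independent u v u∈ v∈ u~v with x∈p∪q⁻ Z Y u∈ | x∈p∪q⁻ Z Y v∈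
      ... | inj₁ u∈Z | inj₁ v∈Z = Z-independent u v u∈Z v∈Z
              (Sum.map (λ e → e , Z⊆R u∈Z , Z⊆R v∈Z) (λ e → e , Z⊆R v∈Z , Z⊆R u∈Z) u~v)
      ... | inj₁ u∈Z | inj₂ v∈Y = no-cross v∈Y u∈Z (swap u~v)
      ... | inj₂ u∈Y | inj₁ v∈Z = no-cross u∈Y v∈Z u~v
      ... | inj₂ u∈Y | inj₂ v∈Y = S-independent u v (Y⊆S u∈Y) (Y⊆S v∈Y) u~v

    -- Adding `Y` to a stable set of the remainder that beats `S ─ Y` would give a stable set of `D`
    -- that beats `S`.
    remainder-maximum : MaximumStable (induced D R) (S ─ Y)
    remainder-maximum = remainder-stable ,
      ≤-antisym (stable⇒∣S∣≤α (induced D R) (S ─ Y) remainder-stable) α≤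
      where
      open ≤-Reasoning
      α≤ : α (induced D R) ≤ ∣ S ─ Y ∣
      α≤ with maximumStable-exists (induced D R)
      ... | Z , Z-stable , ∣Z∣≡α = +-cancelʳ-≤ ∣ Y ∣ _ _ (begin
        α (induced D R) + ∣ Y ∣  ≡⟨ cong (_+ ∣ Y ∣) (sym ∣Z∣≡α) ⟩
        ∣ Z ∣ + ∣ Y ∣            ≤⟨ disjoint⇒∣p∣+∣q∣≤∣p∪q∣ (λ v∈Z v∈Y →
                                    x∈p─q⇒x∉q (V D) U (proj₁ Z-stable v∈Z) (x∈p∪q⁺ (inj₁ v∈Y))) ⟩
        ∣ Z ∪ Y ∣                ≤⟨ stable⇒∣S∣≤α D (Z ∪ Y) (stable-∪ Z-stable) ⟩
        α D                      ≡⟨ sym (proj₂ maximum) ⟩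
        ∣ S ∣                    ≤⟨ ∣p∣≤∣p─q∣+∣q∣ S Y ⟩
        ∣ S ─ Y ∣ + ∣ Y ∣        ∎)

    remainder-partitionable : αProperty (induced D R) → Partitionable R
    remainder-partitionable αR with αR (S ─ Y) remainder-maximum
    ... | 𝒫 , partition , orth =
      fromPaths (p─q⊆p (V D) U) 𝒫 partition (λ i → vertexSet⊆V (induced D R) (lookup 𝒫 i))
        (All.map (λ {P} → trans (cong ∣_∣ (P∩S≡P∩S─Y P))) orth)
      where
      -- The partition obtained is orthogonal to `S ─ Y`; paths inside `R` avoid `Y`, so they meet
      -- `S` in the same vertices.
      P∩S≡P∩S─Y : ∀ (P : Path (induced D R)) → vertexSet P ∩ S ≡ vertexSet P ∩ (S ─ Y)
      P∩S≡P∩S─Y P = ⊆-antisym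
        (λ v∈ → x∈p∩q⁺ (p∩q⊆p p S v∈ , x∈p∧x∉q⇒x∈p─q (p∩q⊆q p S v∈) λ v∈Y →
          x∈p─q⇒x∉q (V D) U (vertexSet⊆V (induced D R) P (p∩q⊆p p S v∈)) (x∈p∪q⁺ (inj₁ v∈Y))))
        (λ v∈ → x∈p∩q⁺ (p∩q⊆p p (S ─ Y) v∈ , p─q⊆p S Y (p∩q⊆q p (S ─ Y) v∈)))
        where p = vertexSet P

-- Combining the matched closure with the partition of the rest.

theorem15 : ∀ {n : ℕ} (D : Digraph n) →
    (∀ (U : Subset n) → U ⊂ V D → αProperty (induced D U)) →
    ∣ V D ∣ ≤ 2 * α D →
    αProperty D
theorem15 D proper ∣V∣≤2α S maximum with nonempty? S
-- An empty `S` forces `α D` to be 0, so the size bound leaves no vertices.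
... | no S-empty = [] , (λ v v∈V → contradiction (v , v∈V) V-empty) , []
  where
  V-empty : Empty (V D)
  V-empty (v , v∈V) = n≮0 (≤-trans (x∈p⇒∣p-x∣<∣p∣ v∈V) (≤-trans ∣V∣≤2α
    (≤-reflexive (cong (2 *_) (trans (sym (proj₂ maximum)) (Empty⇒∣p∣≡0 S-empty))))))
... | yes S-nonempty
  with ∃-hall-closure D S (⊂-wellFounded S) S-nonempty ⊆-refl (∣NS∣≤∣S∣ D S maximum ∣V∣≤2α)
... | Y , (y , y∈Y) , Y⊆S , hall = 𝒫 , unique , orth
  where
  U = closure D S Y
  U⊆V = closure⊆V D S maximum Y⊆S
  y∈U : y ∈ U
  y∈U = x∈p∪q⁺ (inj₁ y∈Y)
  rest-partitionable : Partitionable D S (V D ─ U)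
  rest-partitionable = remainder-partitionable D S maximum Y⊆S
    -- The vertex `y` of the closure makes the remainder a proper subset.
    (proper (V D ─ U) (p∩q≢∅⇒p─q⊂p (V D) U (y , x∈p∩q⁺ (U⊆V y∈U , y∈U))))
  V-paths = toPaths D S (join D S U⊆V
    (hall⇒partitionable D S (⊂-wellFounded U) U⊆V hall) rest-partitionable)
  𝒫 = proj₁ V-paths
  unique = proj₁ (proj₂ V-paths)
  orth = proj₂ (proj₂ (proj₂ V-paths))
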